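{- Let $G$ be a finite graph and let $u,v$ be vertices of $G$. In the independent set toggle group $T(\mathcal{IS}(G))$, $(t_ut_v)^2=1$ if and only if there is no edge between $u$ and $v$ in $G$.
   Context: An independent set in a graph $G$ is a subset of the vertices such that no two have an edge between them; $\mathcal{IS}(G)\subseteq 2^{V(G)}$ is the set of independent sets. For $v\in V(G)$ the toggle $t_v:\mathcal{IS}(G)\to\mathcal{IS}(G)$ is given by $t_v(X)=X\cup\{v\}$ if $v\notin X$ and $X\cup\{v\}\in\mathcal{IS}(G)$; $t_v(X)=X\setminus\{v\}$ if $v\in X$ and $X\setminus\{v\}\in\mathcal{IS}(G)$; and $t_v(X)=X$ otherwise. $T(\mathcal{IS}(G))$ is the subgroup of the symmetric group on $\mathcal{IS}(G)$ generated by all $t_v$, $v\in V(G)$. -}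

module Defs where

open import Algebra.Bundles using (Group; RawGroup)
open import Algebra.Definitions.RawMonoid using (_×_)
open import Algebra.Morphism.GroupMonomorphism using () renaming (isGroup to isGroup-via)
open import Algebra.Morphism.Structures using (IsGroupMonomorphism)
open import Data.Fin.Base using (Fin; zero; suc)
open import Data.Fin.Properties using (all?)
open import Data.Fin.Subset using (Subset; inside; outside; _∈_; _∉_; _⊆_; _∪_; _-_; ⁅_⁆)
open import Data.Fin.Subset.Properties
  using (_∈?_; p─⊥≡p; p─q⊆p; ∪-identityʳ; x∈p∪q⁺; x∈⁅x⁆)
open import Data.Nat.Base using (ℕ)
open import Data.Product.Base using (∃; _,_; proj₁; proj₂)
open import Data.Sum.Base using (inj₂)
open import Data.Vec.Base using (_∷_; here; there)
open import Function.Base using (_∘_)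
open import Function.Bundles using (Inverse)
import Function.Construct.Composition as Composition
import Function.Construct.Identity as Identity
import Function.Construct.Symmetry as Symmetry
open import Level using (Level; 0ℓ; _⊔_)
open import Relation.Binary.Bundles using (Setoid)
open import Relation.Binary.Core using (Rel)
open import Relation.Binary.Definitions using (Decidable; Symmetric; Irreflexive)
open import Relation.Binary.PropositionalEquality
  using (_≡_; refl; sym; trans; cong; subst; setoid)
import Relation.Binary.Construct.On as On
open import Relation.Nullary using (¬_; Dec; yes; no; contradiction; ¬?)
open import Relation.Nullary.Decidable using (_→-dec_)

private
  variable
    a c i ℓ : Level
    n : ℕ

module Power (𝔾 : Group c ℓ) where
  open Group 𝔾

  infixr 8 _^_
  _^_ : Carrier → ℕ → Carrier
  x ^ k = _×_ rawMonoid k x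

-- The product f ∙ g is "first g, then f", and two permutations are equal when
-- they agree pointwise.
SymmetricGroup : Setoid a ℓ → Group (a ⊔ ℓ) (a ⊔ ℓ)
SymmetricGroup {a} {ℓ} S = record
  { Carrier = Inverse S S
  ; _≈_     = _≋_
  ; _∙_     = λ f g → Composition.inverse g f
  ; ε       = Identity.inverse S
  ; _⁻¹     = Symmetry.inverse
  ; isGroup = record
    { isMonoid = record
      { isSemigroup = record
        { isMagma = record
          { isEquivalence = record
            { refl  = λ _ → S.refl
            ; sym   = λ f≋g x → S.sym (f≋g x)
            ; trans = λ f≋g g≋h x → S.trans (f≋g x) (g≋h x)
            }
          ; ∙-cong = λ {f} {f′} {g} {g′} f≋f′ g≋g′ x →
              S.trans (to-cong f (g≋g′ x)) (f≋f′ (to g′ x))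
          }
        ; assoc = λ _ _ _ _ → S.refl
        }
      ; identity = (λ _ _ → S.refl) , (λ _ _ → S.refl)
      }
    ; inverse = (λ f x → strictlyInverseʳ f x) , (λ f x → strictlyInverseˡ f x)
    ; ⁻¹-cong = λ {f} {g} f≋g x →
        S.trans (S.sym (strictlyInverseʳ g (from f x)))
          (from-cong g (S.trans (S.sym (f≋g (from f x))) (strictlyInverseˡ f x)))
    }
  }
  where
  module S = Setoid S
  open Inverse

  _≋_ : Rel (Inverse S S) (a ⊔ ℓ)
  f ≋ g = ∀ x → to f x S.≈ to g x

module _ (𝔾 : Group c ℓ) {I : Set i} (gen : I → Group.Carrier 𝔾) where
  open Group 𝔾 renaming (refl to ≈-refl)

  data Generated : Carrier → Set (c ⊔ ℓ ⊔ i) where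
    generator : ∀ j → Generated (gen j)
    unit      : Generated ε
    product   : ∀ {x y} → Generated x → Generated y → Generated (x ∙ y)
    inv       : ∀ {x} → Generated x → Generated (x ⁻¹)
    resp      : ∀ {x y} → x ≈ y → Generated x → Generated y

  private
    rawSubgroup : RawGroup (c ⊔ ℓ ⊔ i) ℓ
    rawSubgroup = record
      { Carrier = ∃ Generated
      ; _≈_     = λ x y → proj₁ x ≈ proj₁ y
      ; _∙_     = λ (x , p) (y , q) → x ∙ y , product p q
      ; ε       = ε , unit
      ; _⁻¹     = λ (x , p) → x ⁻¹ , inv p
      }

    inclusion : IsGroupMonomorphism rawSubgroup rawGroup proj₁
    inclusion = record
      { isGroupHomomorphism = record
        { isMonoidHomomorphism = record
          { isMagmaHomomorphism = record
            { isRelHomomorphism = record { cong = λ eq → eq }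
            ; homo = λ _ _ → ≈-refl
            }
          ; ε-homo = ≈-refl
          }
        ; ⁻¹-homo = λ _ → ≈-refl
        }
      ; injective = λ eq → eq
      }

  SubgroupGeneratedBy : Group (c ⊔ ℓ ⊔ i) ℓ
  SubgroupGeneratedBy = record
    { RawGroup rawSubgroup
    ; isGroup = isGroup-via inclusion isGroup
    }

-- Simple graphs on Fin n.  Decidability of adjacency, automatic classically, is
-- what allows toggles to be defined by cases.
record Graph (n : ℕ) : Set₁ where
  field
    Adj        : Rel (Fin n) 0ℓ
    adj?       : Decidable Adj
    adj-sym    : Symmetric Adj
    adj-irrefl : Irreflexive _≡_ Adj

open Graph public using (Adj)

private
  ∪-─ : (p : Subset n) (v : Fin n) → v ∉ p → p ∪ ⁅ v ⁆ - v ≡ p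
  ∪-─ (inside  ∷ p) zero    v∉p = contradiction here v∉p
  ∪-─ (outside ∷ p) zero    v∉p = cong (outside ∷_) (trans (p─⊥≡p _) (∪-identityʳ p))
  ∪-─ (inside  ∷ p) (suc v) v∉p = cong (inside ∷_) (∪-─ p v (v∉p ∘ there))
  ∪-─ (outside ∷ p) (suc v) v∉p = cong (outside ∷_) (∪-─ p v (v∉p ∘ there))

  ─-∪ : (p : Subset n) (v : Fin n) → v ∈ p → (p - v) ∪ ⁅ v ⁆ ≡ p
  ─-∪ (inside  ∷ p) zero    here        = cong (inside ∷_) (trans (∪-identityʳ _) (p─⊥≡p p))
  ─-∪ (inside  ∷ p) (suc v) (there v∈p) = cong (inside ∷_) (─-∪ p v v∈p)
  ─-∪ (outside ∷ p) (suc v) (there v∈p) = cong (outside ∷_) (─-∪ p v v∈p)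

  v∉p-v : (p : Subset n) (v : Fin n) → v ∉ p - v
  v∉p-v (inside  ∷ p) zero    ()
  v∉p-v (outside ∷ p) zero    ()
  v∉p-v (_       ∷ p) (suc v) (there v∈) = v∉p-v p v v∈

module _ {n : ℕ} (G : Graph n) where
  open Graph G using (adj?)

  Independent : Subset n → Set
  Independent X = ∀ x y → x ∈ X → y ∈ X → ¬ Adj G x y

  independent? : (X : Subset n) → Dec (Independent X)
  independent? X =
    all? λ x → all? λ y → (x ∈? X) →-dec ((y ∈? X) →-dec ¬? (adj? x y))

  IndependentSet : Set
  IndependentSet = ∃ Independent

  -- Independent sets are compared by their underlying vertex sets, ignoring
  -- the proofs of independence.
  IS : Setoid 0ℓ 0ℓ
  IS = record
    { Carrier       = IndependentSet
    ; _≈_           = λ X Y → proj₁ X ≡ proj₁ Y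
    ; isEquivalence = On.isEquivalence proj₁ (Setoid.isEquivalence (setoid (Subset n)))
    }

  toggle : Fin n → IndependentSet → IndependentSet
  toggle v (X , indX) with v ∈? X
  toggle v (X , indX) | no _ with independent? (X ∪ ⁅ v ⁆)
  ... | yes ind = X ∪ ⁅ v ⁆ , ind
  ... | no _    = X , indX
  toggle v (X , indX) | yes _ with independent? (X - v)
  ... | yes ind = X - v , ind
  ... | no _    = X , indX

  toggle-cong : ∀ v {X Y} → proj₁ X ≡ proj₁ Y → proj₁ (toggle v X) ≡ proj₁ (toggle v Y)
  toggle-cong v {X , _} {.X , _} refl with v ∈? X
  toggle-cong v {X , _} {.X , _} refl | no _ with independent? (X ∪ ⁅ v ⁆)
  ... | yes _ = refl
  ... | no _  = refl
  toggle-cong v {X , _} {.X , _} refl | yes _ with independent? (X - v)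
  ... | yes _ = refl
  ... | no _  = refl

  ⊆-independent : ∀ {X Y} → X ⊆ Y → Independent Y → Independent X
  ⊆-independent X⊆Y ind x y x∈X y∈X = ind x y (X⊆Y x∈X) (X⊆Y y∈X)

  toggle-add : ∀ v X → v ∉ proj₁ X → Independent (proj₁ X ∪ ⁅ v ⁆) →
               proj₁ (toggle v X) ≡ proj₁ X ∪ ⁅ v ⁆
  toggle-add v (X , _) v∉X ind with v ∈? X
  ... | yes v∈X = contradiction v∈X v∉X
  ... | no _ with independent? (X ∪ ⁅ v ⁆)
  ...   | yes _   = refl
  ...   | no ¬ind = contradiction ind ¬ind

  toggle-stay : ∀ v X → v ∉ proj₁ X → ¬ Independent (proj₁ X ∪ ⁅ v ⁆) →
                proj₁ (toggle v X) ≡ proj₁ X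
  toggle-stay v (X , _) v∉X ¬ind with v ∈? X
  ... | yes v∈X = contradiction v∈X v∉X
  ... | no _ with independent? (X ∪ ⁅ v ⁆)
  ...   | yes ind = contradiction ind ¬ind
  ...   | no _    = refl

  toggle-remove : ∀ v X → v ∈ proj₁ X → proj₁ (toggle v X) ≡ proj₁ X - v
  toggle-remove v (X , indX) v∈X with v ∈? X
  ... | no v∉X = contradiction v∈X v∉X
  ... | yes _ with independent? (X - v)
  ...   | yes _   = refl
  ...   | no ¬ind = contradiction (⊆-independent (p─q⊆p X ⁅ v ⁆) indX) ¬ind

  toggle-involutive : ∀ v X → proj₁ (toggle v (toggle v X)) ≡ proj₁ X
  toggle-involutive v 𝕏@(X , indX) = by-cases (v ∈? X) (independent? (X ∪ ⁅ v ⁆))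
    where
    after : ∀ (Y : IndependentSet) → proj₁ (toggle v 𝕏) ≡ proj₁ Y →
            proj₁ (toggle v (toggle v 𝕏)) ≡ proj₁ (toggle v Y)
    after Y = toggle-cong v {toggle v 𝕏} {Y}

    by-cases : Dec (v ∈ X) → Dec (Independent (X ∪ ⁅ v ⁆)) →
               proj₁ (toggle v (toggle v 𝕏)) ≡ X
    by-cases (yes v∈X) _ =
      trans (after Y (toggle-remove v 𝕏 v∈X))
        (trans (toggle-add v Y (v∉p-v X v) (subst Independent (sym X≡) indX)) X≡)
      where
      X≡ = ─-∪ X v v∈X
      Y : IndependentSet
      Y = X - v , ⊆-independent (p─q⊆p X ⁅ v ⁆) indX
    by-cases (no v∉X) (yes ind) =
      trans (after Y (toggle-add v 𝕏 v∉X ind))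
        (trans (toggle-remove v Y (x∈p∪q⁺ (inj₂ (x∈⁅x⁆ v)))) (∪-─ X v v∉X))
      where
      Y : IndependentSet
      Y = X ∪ ⁅ v ⁆ , ind
    by-cases (no v∉X) (no ¬ind) =
      trans (after 𝕏 (toggle-stay v 𝕏 v∉X ¬ind)) (toggle-stay v 𝕏 v∉X ¬ind)

  togglePermutation : Fin n → Inverse IS IS
  togglePermutation v = record
    { to        = toggle v
    ; from      = toggle v
    ; to-cong   = toggle-cong v
    ; from-cong = toggle-cong v
    ; inverse   = cancel , cancel
    }
    where
    cancel : ∀ {X Y} → proj₁ Y ≡ proj₁ (toggle v X) → proj₁ (toggle v Y) ≡ proj₁ X
    cancel {X} {Y} eq = trans (toggle-cong v {Y} {toggle v X} eq) (toggle-involutive v X)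

  ToggleGroup : Group 0ℓ 0ℓ
  ToggleGroup = SubgroupGeneratedBy (SymmetricGroup IS) togglePermutation

  t : Fin n → Group.Carrier ToggleGroup
  t v = togglePermutation v , generator v

{-# OPTIONS --safe #-}
-- Since toggles are involutions, (t_u t_v)² = 1 says that t_u and t_v commute.
-- The toggle t_v changes membership of v only, and v ∈ t_v X holds iff v and all
-- its neighbours lie outside X.  If u ≠ v are not adjacent, this condition is
-- unaffected by t_u, so the toggles commute.  If u and v are adjacent, then v
-- belongs to t_u (t_v ∅) = {v} but not to t_v (t_u ∅) = {u}.
module Submission where

open import Defs
open import Algebra.Bundles using (Group)
open import Data.Fin.Base using (Fin; zero; suc)
open import Data.Fin.Properties using (_≟_)
open import Data.Fin.Subset using (Subset; inside; outside; _∈_; _∉_; _⊆_; _∪_; _-_; ⁅_⁆; ⊥)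
open import Data.Fin.Subset.Properties
  using (_∈?_; ∉⊥; ⊆-antisym; p─q⊆p; x∈p∪q⁺; x∈p∪q⁻; x∈⁅x⁆; x∈⁅y⁆⇒x≡y; x∈p∧x≢y⇒x∈p-y)
open import Data.Nat.Base using (ℕ)
open import Data.Product.Base using (_×_; _,_; proj₁; proj₂)
open import Data.Sum.Base using (inj₁; inj₂; [_,_]′)
open import Data.Vec.Base using (_∷_; there)
open import Function.Base using (_∘_; id)
open import Function.Bundles using (_⇔_; mk⇔; Equivalence)
open import Relation.Binary.Bundles using (Setoid)
open import Relation.Binary.PropositionalEquality
  using (_≢_; refl; sym; subst; ≢-sym)
import Relation.Binary.Reasoning.Setoid as ≈-Reasoning
open import Relation.Nullary using (¬_; yes; no; contradiction)

open Equivalence using (to; from)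

x∉p-x : ∀ {n} {p : Subset n} x → x ∉ p - x
x∉p-x {p = inside  ∷ p} zero    ()
x∉p-x {p = outside ∷ p} zero    ()
x∉p-x {p = _       ∷ p} (suc x) (there x∈) = x∉p-x x x∈

module _ {n : ℕ} (G : Graph n) where
  open Graph G using (adj-sym; adj-irrefl)
  open Setoid (IS G) using (_≈_)

  -- Phrased through membership of single vertices, so that it can be compared between sets
  -- differing at one vertex. For independent `X` and `v ∉ X` it amounts to independence of
  -- `X ∪ ⁅ v ⁆`.
  Addable : Fin n → Subset n → Set
  Addable v X = v ∉ X × (∀ {y} → y ∈ X → ¬ Adj G v y)

  addable⇒independent : ∀ {v X} → Independent G X → Addable v X →
                        Independent G (X ∪ ⁅ v ⁆)
  addable⇒independent {v} {X} indX (_ , v≁X) x y x∈ y∈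
    with x∈p∪q⁻ X ⁅ v ⁆ x∈ | x∈p∪q⁻ X ⁅ v ⁆ y∈
  ... | inj₁ x∈X | inj₁ y∈X = indX x y x∈X y∈X
  ... | inj₁ x∈X | inj₂ y∈v rewrite x∈⁅y⁆⇒x≡y v y∈v = v≁X x∈X ∘ adj-sym
  ... | inj₂ x∈v | inj₁ y∈X rewrite x∈⁅y⁆⇒x≡y v x∈v = v≁X y∈X
  ... | inj₂ x∈v | inj₂ y∈v rewrite x∈⁅y⁆⇒x≡y v x∈v | x∈⁅y⁆⇒x≡y v y∈v = adj-irrefl refl

  independent⇒addable : ∀ {v X} → v ∉ X → Independent G (X ∪ ⁅ v ⁆) → Addable v X
  independent⇒addable {v} v∉X ind =
    v∉X , λ y∈X → ind v _ (x∈p∪q⁺ (inj₂ (x∈⁅x⁆ v))) (x∈p∪q⁺ (inj₁ y∈X))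

  -- The condition concerns only `v` and its neighbours, and `u` is neither, so `Y` may differ from
  -- `X` arbitrarily at `u`. Elsewhere, shrinking the set preserves it.
  addable-resp : ∀ {u v X Y} → v ≢ u → ¬ Adj G v u →
                 (∀ {y} → y ≢ u → y ∈ Y → y ∈ X) → Addable v X → Addable v Y
  addable-resp {u} {v} {Y = Y} v≢u v≁u Y⊆X (v∉X , v≁X) = v∉X ∘ Y⊆X v≢u , v≁Y
    where
    v≁Y : ∀ {y} → y ∈ Y → ¬ Adj G v y
    v≁Y {y} y∈Y with y ≟ u
    ... | yes refl = v≁u
    ... | no  y≢u  = v≁X (Y⊆X y≢u y∈Y)

  -- The graph of the toggle as a relation: one match yields both the resulting set and the reason
  -- for it.
  data Toggled (v : Fin n) (X : Subset n) : Subset n → Set where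
    removed : v ∈ X → Toggled v X (X - v)
    added   : Addable v X → Toggled v X (X ∪ ⁅ v ⁆)
    stayed  : v ∉ X → ¬ Addable v X → Toggled v X X

  toggled : ∀ v X → Toggled v (proj₁ X) (proj₁ (toggle G v X))
  toggled v (X , indX) with v ∈? X
  toggled v (X , indX) | no v∉X with independent? G (X ∪ ⁅ v ⁆)
  ... | yes ind = added (independent⇒addable v∉X ind)
  ... | no ¬ind = stayed v∉X (¬ind ∘ addable⇒independent indX)
  toggled v (X , indX) | yes v∈X with independent? G (X - v)
  ... | yes _   = removed v∈X
  -- Removal is never blocked, since independence passes to subsets.
  ... | no ¬ind = contradiction (⊆-independent G (p─q⊆p X ⁅ v ⁆) indX) ¬ind

  ∈-toggle-other : ∀ {x v} X → x ≢ v → x ∈ proj₁ (toggle G v X) ⇔ x ∈ proj₁ X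
  ∈-toggle-other {v = v} 𝕏@(X , _) x≢v with proj₁ (toggle G v 𝕏) | toggled v 𝕏
  ... | _ | removed _  = mk⇔ (p─q⊆p X ⁅ v ⁆) (λ x∈X → x∈p∧x≢y⇒x∈p-y x∈X x≢v)
  ... | _ | stayed _ _ = mk⇔ id id
  ... | _ | added _    =
    mk⇔ ([ id , (λ x∈v → contradiction (x∈⁅y⁆⇒x≡y v x∈v) x≢v) ]′ ∘ x∈p∪q⁻ X ⁅ v ⁆)
        (x∈p∪q⁺ ∘ inj₁)

  ∈-toggle-self : ∀ v X → v ∈ proj₁ (toggle G v X) ⇔ Addable v (proj₁ X)
  ∈-toggle-self v 𝕏@(X , _) with proj₁ (toggle G v 𝕏) | toggled v 𝕏
  ... | _ | removed v∈X     =
    mk⇔ (λ v∈X-v → contradiction v∈X-v (x∉p-x v)) (λ (v∉X , _) → contradiction v∈X v∉X)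
  ... | _ | added add       = mk⇔ (λ _ → add) (λ _ → x∈p∪q⁺ (inj₂ (x∈⁅x⁆ v)))
  ... | _ | stayed v∉X ¬add =
    mk⇔ (λ v∈X → contradiction v∈X v∉X) (λ add → contradiction add ¬add)

  Commute : Fin n → Fin n → Set
  Commute u v = ∀ X → toggle G u (toggle G v X) ≈ toggle G v (toggle G u X)

  -- At `u` only the toggle at `u` matters; it acts on `toggle G v X` on one side and on `X` on the
  -- other, and `u` is addable to both or to neither. The vertex `v` is symmetric, and at any other
  -- vertex both sides agree with `X`.
  toggle²⊆ : ∀ {u v} → u ≢ v → ¬ Adj G u v → ∀ X →
             proj₁ (toggle G u (toggle G v X)) ⊆ proj₁ (toggle G v (toggle G u X))
  toggle²⊆ {u} {v} u≢v u≁v X {x} x∈ with x ≟ u | x ≟ v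
  ... | yes refl | _ =
    from (∈-toggle-other (toggle G u X) u≢v)
      (from (∈-toggle-self u X)
        (addable-resp u≢v u≁v (λ y≢v → from (∈-toggle-other X y≢v))
          (to (∈-toggle-self u (toggle G v X)) x∈)))
  ... | no v≢u | yes refl =
    from (∈-toggle-self v (toggle G u X))
      (addable-resp v≢u (u≁v ∘ adj-sym) (λ y≢u → to (∈-toggle-other X y≢u))
        (to (∈-toggle-self v X) (to (∈-toggle-other (toggle G v X) v≢u) x∈)))
  ... | no x≢u | no x≢v =
    from (∈-toggle-other (toggle G u X) x≢v)
      (from (∈-toggle-other X x≢u)
        (to (∈-toggle-other X x≢v) (to (∈-toggle-other (toggle G v X) x≢u) x∈)))

  nonadjacent⇒commute : ∀ {u v} → ¬ Adj G u v → Commute u v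
  nonadjacent⇒commute {u} {v} u≁v X with u ≟ v
  ... | yes refl = refl
  ... | no u≢v   =
    -- The reverse inclusion is the same lemma with `u` and `v` exchanged.
    ⊆-antisym (toggle²⊆ u≢v u≁v X) (toggle²⊆ (≢-sym u≢v) (u≁v ∘ adj-sym) X)

  commute⇒nonadjacent : ∀ {u v} → Commute u v → ¬ Adj G u v
  commute⇒nonadjacent {u} {v} comm u∼v =
    -- Addability of `v` to `toggle G u ∅` excludes neighbours of `v` from that set, yet it contains
    -- `u`.
    proj₂ (to (∈-toggle-self v (toggle G u ∅)) v∈tᵥtᵤ∅) (∈-toggle-∅ u) (adj-sym u∼v)
    where
    ∅ : IndependentSet G
    ∅ = ⊥ , λ _ _ x∈⊥ → contradiction x∈⊥ ∉⊥

    ∈-toggle-∅ : ∀ w → w ∈ proj₁ (toggle G w ∅)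
    ∈-toggle-∅ w = from (∈-toggle-self w ∅) (∉⊥ , λ y∈⊥ → contradiction y∈⊥ ∉⊥)

    v≢u : v ≢ u
    v≢u v≡u = adj-irrefl (sym v≡u) u∼v

    v∈tᵥtᵤ∅ : v ∈ proj₁ (toggle G v (toggle G u ∅))
    v∈tᵥtᵤ∅ =
      subst (v ∈_) (comm ∅) (from (∈-toggle-other (toggle G v ∅) v≢u) (∈-toggle-∅ v))

module _ {c ℓ} (𝔾 : Group c ℓ) where
  open Group 𝔾
  open Power 𝔾
  open import Algebra.Properties.Group 𝔾 using (inverseˡ-unique; ⁻¹-anti-homo-∙; inverseʳ-unique)
  open ≈-Reasoning setoid

  -- For involutions `b ∙ a` is the inverse of `a ∙ b`, so both sides say that `a ∙ b` is its own
  -- inverse.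
  square≈ε⇔commute : ∀ {a b} → a ∙ a ≈ ε → b ∙ b ≈ ε → ((a ∙ b) ^ 2 ≈ ε) ⇔ (a ∙ b ≈ b ∙ a)
  square≈ε⇔commute {a} {b} aa≈ε bb≈ε = mk⇔ ⇒ ⇐
    where
    [ab]⁻¹≈ba : (a ∙ b) ⁻¹ ≈ b ∙ a
    [ab]⁻¹≈ba = begin
      (a ∙ b) ⁻¹    ≈⟨ ⁻¹-anti-homo-∙ a b ⟩
      b ⁻¹ ∙ a ⁻¹   ≈⟨ ∙-cong (inverseˡ-unique b b bb≈ε) (inverseˡ-unique a a aa≈ε) ⟨
      b ∙ a         ∎

    ⇒ : (a ∙ b) ^ 2 ≈ ε → a ∙ b ≈ b ∙ a
    ⇒ abab≈ε = begin
      -- The square unfolds to `a ∙ b ∙ (a ∙ b ∙ ε)`, so the right inverse it provides is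
      -- `a ∙ b ∙ ε`.
      a ∙ b         ≈⟨ identityʳ (a ∙ b) ⟨
      a ∙ b ∙ ε     ≈⟨ inverseʳ-unique (a ∙ b) _ abab≈ε ⟩
      (a ∙ b) ⁻¹    ≈⟨ [ab]⁻¹≈ba ⟩
      b ∙ a         ∎

    ⇐ : a ∙ b ≈ b ∙ a → (a ∙ b) ^ 2 ≈ ε
    ⇐ ab≈ba = begin
      a ∙ b ∙ (a ∙ b ∙ ε)   ≈⟨ ∙-congˡ (identityʳ (a ∙ b)) ⟩
      a ∙ b ∙ (a ∙ b)       ≈⟨ ∙-congˡ ab≈ba ⟩
      a ∙ b ∙ (b ∙ a)       ≈⟨ ∙-congˡ [ab]⁻¹≈ba ⟨
      a ∙ b ∙ (a ∙ b) ⁻¹    ≈⟨ inverseʳ (a ∙ b) ⟩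
      ε                     ∎

lemma3p23 : ∀ {n : ℕ} (G : Graph n) (u v : Fin n) →
    let open Group (ToggleGroup G)
        open Power (ToggleGroup G)
    in ((t G u ∙ t G v) ^ 2 ≈ ε) ⇔ (¬ Adj G u v)
lemma3p23 G u v = mk⇔ (commute⇒nonadjacent G ∘ to square⇔commute)
                      (from square⇔commute ∘ nonadjacent⇒commute G)
  where
  -- Equality in the toggle group is pointwise, so commutation of `t G u` and `t G v` unfolds to
  -- `Commute G u v`.
  square⇔commute = square≈ε⇔commute (ToggleGroup G) {t G u} {t G v}
                     (toggle-involutive G u) (toggle-involutive G v)
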